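{- $q(4) = 9$, where for a positive integer $k$, $q(k)$ denotes the smallest integer $n$ such that there exists an intersecting $k$-family of transversal size $k$ and length $n$.
   Context: A $k$-set is a set with $k$ elements. A $k$-family is a collection of $k$-sets; its members are called blocks, and its length (or size) is the number of blocks in it. A $k$-family $\mathcal{F}$ is intersecting if $F \cap G \neq \emptyset$ for all $F, G \in \mathcal{F}$. A set $C$ is a covering set of $\mathcal{F}$ if $C \cap F \neq \emptyset$ for all $F \in \mathcal{F}$. The transversal size of $\mathcal{F}$ is the smallest integer $t$ such that there exists a covering set of $\mathcal{F}$ with exactly $t$ elements. -}

module Defs where

open import Data.Nat using (ℕ; _≤_; NonZero)
open import Data.Fin.Subset using (Subset; _∩_; ∣_∣; Nonempty)
open import Data.List using (List; length)
open import Data.List.Membership.Propositional using (_∈_)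
open import Data.List.Relation.Unary.Unique.Propositional using (Unique)
open import Data.Product using (_×_; ∃-syntax)
open import Relation.Binary.PropositionalEquality using (_≡_)

IsSmallest : (ℕ → Set) → ℕ → Set
IsSmallest P n = P n × (∀ n′ → P n′ → n ≤ n′)

-- Finite families of finite sets only involve finitely many points, so blocks
-- are taken to be subsets of Fin m; the number m of points is unrestricted.
-- The family is a set of blocks, presented as a list without repetitions.
record Family (k m : ℕ) : Set where
  field
    blocks  : List (Subset m)
    unique  : Unique blocks
    uniform : ∀ {F} → F ∈ blocks → ∣ F ∣ ≡ k

open Family public

module _ {k m : ℕ} where

  size : Family k m → ℕ
  size 𝓕 = length (blocks 𝓕)

  Intersecting : Family k m → Set
  Intersecting 𝓕 = ∀ {F G} → F ∈ blocks 𝓕 → G ∈ blocks 𝓕 → Nonempty (F ∩ G)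

  Covers : Subset m → Family k m → Set
  Covers C 𝓕 = ∀ {F} → F ∈ blocks 𝓕 → Nonempty (C ∩ F)

  IsTransversalSize : Family k m → ℕ → Set
  IsTransversalSize 𝓕 = IsSmallest (λ t → ∃[ C ] (Covers C 𝓕 × ∣ C ∣ ≡ t))

-- q[ k ]≡ n is the assertion q(k) = n.
q[_]≡_ : (k : ℕ) .{{_ : NonZero k}} → ℕ → Set
q[ k ]≡ n = IsSmallest (λ l → ∃[ m ] ∃[ 𝓕 ] (Intersecting {k} {m} 𝓕 × IsTransversalSize 𝓕 k × size 𝓕 ≡ l)) n

{-# OPTIONS --safe #-}

-- Dualise: for a point x let D x be the set of blocks through x.  Suppose that
-- eight blocks admit no covering set of three points.  Any two blocks are
-- covered by one point, so ∣ D x ∪ D y ∣ ≤ 5 for all points x, y, and likewise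
-- ∣ D x ∣ ≤ 3.  By submodularity of cardinality every block v has three points
-- x, y, z with ∣ D x ∪ D y ∪ D z ∣ = 7; let u be the block they miss.  Each
-- point w of u with ∣ D w ∣ = 3 lies on v, since otherwise D w would have to
-- share three different blocks with D x, D y, D z besides containing u.  So
-- each of the four points of u lies on at most one block, or on v and at most
-- one block, other than u, and u meets at most five other blocks.  Fewer than
-- eight blocks are padded by repeating one of them.

module Submission where

open import Data.Nat using (ℕ; nonZero; suc; _+_; _≤_; _<_; s≤s; _<?_; _≤?_)
open import Data.Nat.Properties
import Data.Bool.Properties as Bool
open import Data.Empty using (⊥)
open import Data.Fin using (Fin; zero; suc; #_)
import Data.Fin.Properties as Fin
open import Data.Fin.Subset using (Subset; inside; outside; _∈_; _∉_; _⊆_; _∪_; _∩_; ∣_∣; ⁅_⁆; ⊤; ⋃; Nonempty)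
import Data.Fin.Subset as Subset
open import Data.Fin.Subset.Properties
open import Data.List using (List; []; _∷_; length; map)
open import Data.List.Membership.Propositional renaming (_∈_ to _∈ₗ_) using ()
open import Data.List.Relation.Unary.All as All using (All)
open import Data.List.Relation.Unary.Any using (here; there)
open import Data.List.Relation.Unary.Unique.DecPropositional using (unique?)
open import Data.Product using (_×_; _,_; proj₁; proj₂; ∃-syntax)
open import Data.Sum using (_⊎_; inj₁; inj₂; [_,_]′)
open import Data.Vec using ([]; _∷_; here; there; tabulate; lookup)
open import Data.Vec.Properties using (≡-dec; []=⇒lookup; lookup⇒[]=; lookup∘tabulate)
open import Function using (_∘_)
open import Relation.Binary.PropositionalEquality using (_≡_; refl; sym; trans; cong; subst; module ≡-Reasoning)
open import Relation.Nullary using (¬_; yes; no; contradiction)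
open import Relation.Nullary.Decidable using (toWitness; toWitnessFalse; _×-dec_; decidable-stable)
open import Defs

-- Cardinalities of unions of finite sets.

∣p∪q∣+∣p∩q∣≡∣p∣+∣q∣ : ∀ {n} (p q : Subset n) → ∣ p ∪ q ∣ + ∣ p ∩ q ∣ ≡ ∣ p ∣ + ∣ q ∣
∣p∪q∣+∣p∩q∣≡∣p∣+∣q∣ []            []            = refl
∣p∪q∣+∣p∩q∣≡∣p∣+∣q∣ (outside ∷ p) (outside ∷ q) = ∣p∪q∣+∣p∩q∣≡∣p∣+∣q∣ p q
∣p∪q∣+∣p∩q∣≡∣p∣+∣q∣ (inside  ∷ p) (outside ∷ q) = cong suc (∣p∪q∣+∣p∩q∣≡∣p∣+∣q∣ p q)
∣p∪q∣+∣p∩q∣≡∣p∣+∣q∣ (outside ∷ p) (inside  ∷ q) =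
  trans (cong suc (∣p∪q∣+∣p∩q∣≡∣p∣+∣q∣ p q)) (sym (+-suc ∣ p ∣ ∣ q ∣))
∣p∪q∣+∣p∩q∣≡∣p∣+∣q∣ (inside  ∷ p) (inside  ∷ q) = cong suc (begin
  ∣ p ∪ q ∣ + suc ∣ p ∩ q ∣   ≡⟨ +-suc ∣ p ∪ q ∣ ∣ p ∩ q ∣ ⟩
  suc (∣ p ∪ q ∣ + ∣ p ∩ q ∣) ≡⟨ cong suc (∣p∪q∣+∣p∩q∣≡∣p∣+∣q∣ p q) ⟩
  suc (∣ p ∣ + ∣ q ∣)         ≡⟨ +-suc ∣ p ∣ ∣ q ∣ ⟨
  ∣ p ∣ + suc ∣ q ∣           ∎)
  where open ≡-Reasoning

module _ {n : ℕ} where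

  ∪-least : {p q r : Subset n} → p ⊆ r → q ⊆ r → p ∪ q ⊆ r
  ∪-least {p} {q} p⊆r q⊆r x∈ = [ p⊆r , q⊆r ]′ (x∈p∪q⁻ p q x∈)

  ∪-monoˡ : {p q : Subset n} (r : Subset n) → p ⊆ q → p ∪ r ⊆ q ∪ r
  ∪-monoˡ {q = q} r p⊆q = ∪-least (p⊆p∪q r ∘ p⊆q) (q⊆p∪q q r)

  ∪-monoʳ : {p q : Subset n} (r : Subset n) → p ⊆ q → r ∪ p ⊆ r ∪ q
  ∪-monoʳ {q = q} r p⊆q = ∪-least (p⊆p∪q q) (q⊆p∪q r q ∘ p⊆q)

  ⁅x⁆⊆ : {x : Fin n} {p : Subset n} → x ∈ p → ⁅ x ⁆ ⊆ p
  ⁅x⁆⊆ {x} {p} x∈p y∈ = subst (_∈ p) (sym (x∈⁅y⁆⇒x≡y x y∈)) x∈p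

  ∪-submodular : {p q r : Subset n} → r ⊆ p → r ⊆ q → ∣ p ∪ q ∣ + ∣ r ∣ ≤ ∣ p ∣ + ∣ q ∣
  ∪-submodular {p} {q} {r} r⊆p r⊆q = begin
    ∣ p ∪ q ∣ + ∣ r ∣     ≤⟨ +-monoʳ-≤ ∣ p ∪ q ∣ (p⊆q⇒∣p∣≤∣q∣ (λ x∈ → x∈p∩q⁺ (r⊆p x∈ , r⊆q x∈))) ⟩
    ∣ p ∪ q ∣ + ∣ p ∩ q ∣ ≡⟨ ∣p∪q∣+∣p∩q∣≡∣p∣+∣q∣ p q ⟩
    ∣ p ∣ + ∣ q ∣         ∎
    where open ≤-Reasoning

  -- Gluing two sets along `r` saves `c`, so `d` is `a + b - c`; the equation replaces subtraction
  -- and is settled by `refl` for numerals.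
  ∣p∪q∣≤ : ∀ {a b c} d {p q r : Subset n} → a + b ≡ d + c → r ⊆ p → r ⊆ q →
           c ≤ ∣ r ∣ → ∣ p ∣ ≤ a → ∣ q ∣ ≤ b → ∣ p ∪ q ∣ ≤ d
  ∣p∪q∣≤ {a} {b} {c} d {p} {q} {r} a+b≡d+c r⊆p r⊆q c≤r p≤a q≤b = +-cancelʳ-≤ c _ d (begin
    ∣ p ∪ q ∣ + c     ≤⟨ +-monoʳ-≤ ∣ p ∪ q ∣ c≤r ⟩
    ∣ p ∪ q ∣ + ∣ r ∣ ≤⟨ ∪-submodular r⊆p r⊆q ⟩
    ∣ p ∣ + ∣ q ∣     ≤⟨ +-mono-≤ p≤a q≤b ⟩
    a + b             ≡⟨ a+b≡d+c ⟩
    d + c             ∎)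
    where open ≤-Reasoning

  ∣p∪q∣≤∣p∣+∣q∣ : (p q : Subset n) → ∣ p ∪ q ∣ ≤ ∣ p ∣ + ∣ q ∣
  ∣p∪q∣≤∣p∣+∣q∣ p q = m+n≤o⇒m≤o ∣ p ∪ q ∣ (≤-reflexive (∣p∪q∣+∣p∩q∣≡∣p∣+∣q∣ p q))

  ∣p∣<∣p∪q∣ : {x : Fin n} {p q : Subset n} → x ∉ p → x ∈ q → ∣ p ∣ < ∣ p ∪ q ∣
  ∣p∣<∣p∪q∣ {x} {p} {q} x∉p x∈q = p⊂q⇒∣p∣<∣q∣ (p⊆p∪q q , x , q⊆p∪q p q x∈q , x∉p)

  ∣p∣<n⇒∃∉ : (p : Subset n) → ∣ p ∣ < n → ∃[ x ] x ∉ p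
  ∣p∣<n⇒∃∉ p ∣p∣<n = Fin.¬∀⟶∃¬ n (_∈ p) (_∈? p)
    λ all → <⇒≱ ∣p∣<n (subst (_≤ ∣ p ∣) (∣⊤∣≡n n) (p⊆q⇒∣p∣≤∣q∣ {p = ⊤} (λ _ → all _)))

  -- The union of `p ∪ r` and `q ∪ r` contains `(p ∪ q) ∪ r`, and their intersection contains `r`.
  pair-submodular : (p q r : Subset n) → ∣ (p ∪ q) ∪ r ∣ + ∣ r ∣ ≤ ∣ p ∪ r ∣ + ∣ q ∪ r ∣
  pair-submodular p q r = ≤-trans
    (+-monoˡ-≤ ∣ r ∣ (p⊆q⇒∣p∣≤∣q∣ (∪-least (∪-least (p⊆p∪q _ ∘ p⊆p∪q r) (q⊆p∪q _ _ ∘ p⊆p∪q r))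
                                           (p⊆p∪q _ ∘ q⊆p∪q p r))))
    (∪-submodular (q⊆p∪q p r) (q⊆p∪q q r))

-- Contradiction from eight blocks without a three-point cover, in dual form.

module NoThreeCover
  {X : Set} (D : X → Subset 8) (point : Fin 8 → Fin 4 → X)
  (incident : ∀ i k → i ∈ D (point i k))
  (meet : ∀ i j → ∃[ k ] j ∈ D (point i k))
  (noCover : ∀ x y z → ∣ (D x ∪ D y) ∪ D z ∣ ≤ 7)
  where

  -- Two blocks outside `S` share a point, which adds both. If only one is outside, any of its
  -- points completes all eight, which suffices because `d ≤ 6`.
  extend : ∀ {d} S → d ≤ ∣ S ∣ → ∣ S ∣ < 8 → d ≤ 6 → ∃[ x ] 2 + d ≤ ∣ S ∪ D x ∣
  extend S d≤∣S∣ ∣S∣<8 d≤6 with ∣p∣<n⇒∃∉ S ∣S∣<8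
  ... | i , i∉S with ∣ S ∪ ⁅ i ⁆ ∣ <? 8
  ...   | no ≮8 = point i zero , ≤-trans (+-monoʳ-≤ 2 d≤6) (≤-trans (≮⇒≥ ≮8)
                    (p⊆q⇒∣p∣≤∣q∣ (∪-monoʳ S (⁅x⁆⊆ (incident i zero)))))
  ...   | yes <8 with ∣p∣<n⇒∃∉ (S ∪ ⁅ i ⁆) <8
  ...     | j , j∉S∪i with meet i j
  ...       | k , j∈ = point i k , ≤-trans (+-monoʳ-≤ 2 d≤∣S∣) (≤-trans
                (s≤s (∣p∣<∣p∪q∣ {p = S} i∉S (x∈⁅x⁆ i)))
                (p⊂q⇒∣p∣<∣q∣ ( ∪-monoʳ S (⁅x⁆⊆ (incident i k))
                             , j , q⊆p∪q S (D (point i k)) j∈ , j∉S∪i)))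

  -- A pair on six blocks would extend to a triple on all eight.
  pair≤5 : ∀ x y → ∣ D x ∪ D y ∣ ≤ 5
  pair≤5 x y = ≮⇒≥ λ 6≤ →
    let z , 8≤ = extend (D x ∪ D y) 6≤ (s≤s (≤-trans (∣p∣≤∣p∪q∣ (D x ∪ D y) (D x)) (noCover x y x))) ≤-refl
    in <⇒≱ 8≤ (noCover x y z)

  -- A point on four blocks would extend to a pair on six.
  degree≤3 : ∀ x → ∣ D x ∣ ≤ 3
  degree≤3 x = ≮⇒≥ λ 4≤ →
    let y , 6≤ = extend (D x) 4≤ (≤-trans (s≤s (≤-trans (∣p∣≤∣p∪q∣ (D x) (D x)) (pair≤5 x x))) (m≤n+m 6 2))
                              (m≤n+m 4 2)
    in <⇒≱ 6≤ (pair≤5 x y)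

  -- Bracketed in pairs so that either pair can serve as `r` in `large-triple`.
  neighbours : Fin 8 → Subset 8
  neighbours i = (E (# 0) ∪ E (# 1)) ∪ (E (# 2) ∪ E (# 3))
    where E = D ∘ point i

  8≤∣neighbours∣ : ∀ i → 8 ≤ ∣ neighbours i ∣
  8≤∣neighbours∣ i = p⊆q⇒∣p∣≤∣q∣ {p = ⊤} λ {j} _ → located j (meet i j)
    where
    E = D ∘ point i
    located : ∀ j → ∃[ k ] j ∈ E k → j ∈ neighbours i
    located j (zero                , j∈) = p⊆p∪q _ (p⊆p∪q _ j∈)
    located j (suc zero            , j∈) = p⊆p∪q _ (q⊆p∪q (E (# 0)) _ j∈)
    located j (suc (suc zero)      , j∈) = q⊆p∪q (E (# 0) ∪ E (# 1)) _ (p⊆p∪q _ j∈)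
    located j (suc (suc (suc zero)) , j∈) = q⊆p∪q (E (# 0) ∪ E (# 1)) _ (q⊆p∪q (E (# 2)) _ j∈)

  -- The two sizes sum to at least 8 + 5 = 13, so they cannot both be at most 6.
  large-triple : ∀ (p q r : Subset 8) → 8 ≤ ∣ (p ∪ q) ∪ r ∣ → 5 ≤ ∣ r ∣ →
                 7 ≤ ∣ p ∪ r ∣ ⊎ 7 ≤ ∣ q ∪ r ∣
  large-triple p q r 8≤ 5≤ with 7 ≤? ∣ p ∪ r ∣
  ... | yes 7≤p = inj₁ 7≤p
  ... | no  7≰p = inj₂ (+-cancelˡ-≤ 6 7 _ (begin
    13                        ≤⟨ +-mono-≤ 8≤ 5≤ ⟩
    ∣ (p ∪ q) ∪ r ∣ + ∣ r ∣   ≤⟨ pair-submodular p q r ⟩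
    ∣ p ∪ r ∣ + ∣ q ∪ r ∣     ≤⟨ +-monoˡ-≤ ∣ q ∪ r ∣ (≤-pred (≰⇒> 7≰p)) ⟩
    6 + ∣ q ∪ r ∣             ∎))
    where open ≤-Reasoning

  record Triple (v : Fin 8) : Set where
    constructor triple
    field
      {x y z} : X
      v∈x   : v ∈ D x
      v∈y   : v ∈ D y
      v∈z   : v ∈ D z
      large : 7 ≤ ∣ D x ∪ (D y ∪ D z) ∣

  -- The four points of `v` split into two pairs. A pair on at least five blocks, with a suitable
  -- point of the other pair, gives the triple.
  triple-through : ∀ v → Triple v
  triple-through v with 5 ≤? ∣ D (point v (# 2)) ∪ D (point v (# 3)) ∣
  ... | yes 5≤ =
    [ triple (incident v (# 0)) (incident v (# 2)) (incident v (# 3))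
    , triple (incident v (# 1)) (incident v (# 2)) (incident v (# 3))
    ]′ (large-triple (E (# 0)) (E (# 1)) (E (# 2) ∪ E (# 3)) (8≤∣neighbours∣ v) 5≤)
    where E = D ∘ point v
  ... | no 5≰ with 5 ≤? ∣ D (point v (# 0)) ∪ D (point v (# 1)) ∣
  ...   | yes 5≤ =
    [ triple (incident v (# 2)) (incident v (# 0)) (incident v (# 1))
    , triple (incident v (# 3)) (incident v (# 0)) (incident v (# 1))
    ]′ (large-triple (E (# 2)) (E (# 3)) (E (# 0) ∪ E (# 1))
          (subst (λ p → 8 ≤ ∣ p ∣) (∪-comm (E (# 0) ∪ E (# 1)) _) (8≤∣neighbours∣ v)) 5≤)
    where E = D ∘ point v
  -- Both pairs lie on `v`, so with at most four blocks each they reach at most 4 + 4 - 1 = 7.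
  ...   | no 5≰′ = contradiction (8≤∣neighbours∣ v) (<⇒≱ (s≤s
    (∣p∪q∣≤ 7 refl (⁅x⁆⊆ (p⊆p∪q _ (incident v (# 0)))) (⁅x⁆⊆ (p⊆p∪q _ (incident v (# 2))))
            (≤-reflexive (sym (∣⁅x⁆∣≡1 v))) (≤-pred (≰⇒> 5≰′)) (≤-pred (≰⇒> 5≰)))))

  module _ {v : Fin 8} (t : Triple v) where
    open Triple t

    -- Otherwise `R` has at least 4 elements and lies in the union of `D w` with each of `D x`,
    -- `D y`, `D z`. These unions have size at most 5, so gluing them along `R` gives at most 5 + 1
    -- + 1 = 7 blocks; yet the result contains `u` besides the 7 blocks of the triple.
    degree-3-through-missed : ∀ {u} → u ∉ D x ∪ (D y ∪ D z) → ∀ w → u ∈ D w → 3 ≤ ∣ D w ∣ → v ∈ D w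
    degree-3-through-missed {u} u∉ w u∈w 3≤w = decidable-stable (v ∈? D w) λ v∉w →
      let R = D w ∪ ⁅ v ⁆
          4≤R : 4 ≤ ∣ R ∣
          4≤R = ≤-trans (s≤s 3≤w) (∣p∣<∣p∪q∣ v∉w (x∈⁅x⁆ v))
          R⊆ : ∀ {a} → v ∈ D a → R ⊆ D w ∪ D a
          R⊆ v∈a = ∪-monoʳ (D w) (⁅x⁆⊆ v∈a)
          ≤6 = ∣p∪q∣≤ 6 refl (R⊆ v∈x) (R⊆ v∈y) 4≤R (pair≤5 w x) (pair≤5 w y)
          ≤7 = ∣p∪q∣≤ 7 refl (p⊆p∪q _ ∘ R⊆ v∈x) (R⊆ v∈z) 4≤R ≤6 (pair≤5 w z)
          ⊆all = ∪-least (∪-least (p⊆p∪q _ ∘ p⊆p∪q _ ∘ q⊆p∪q (D w) (D x))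
                   (∪-least (p⊆p∪q _ ∘ q⊆p∪q (D w ∪ D x) _ ∘ q⊆p∪q (D w) (D y))
                            (q⊆p∪q ((D w ∪ D x) ∪ (D w ∪ D y)) _ ∘ q⊆p∪q (D w) (D z))))
                   (p⊆p∪q _ ∘ p⊆p∪q _ ∘ p⊆p∪q (D x))
      in <⇒≱ (≤-trans (s≤s large) (≤-trans (∣p∣<∣p∪q∣ u∉ u∈w) (p⊆q⇒∣p∣≤∣q∣ ⊆all))) ≤7

    missed : ∃[ u ] u ∉ D x ∪ (D y ∪ D z)
    missed = ∣p∣<n⇒∃∉ _ (s≤s (subst (λ p → ∣ p ∣ ≤ 7) (∪-assoc (D x) (D y) (D z)) (noCover x y z)))

    u = proj₁ missed

    -- Adjoining `v` makes all four sets share `u` and `v`, along which they are glued.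
    G : Fin 4 → Subset 8
    G k = D (point u k) ∪ ⁅ v ⁆

    -- A point of degree 3 already lies on `v`, so nothing is added; a smaller degree leaves room
    -- for `v`.
    ∣G∣≤3 : ∀ k → ∣ G k ∣ ≤ 3
    ∣G∣≤3 k with 3 ≤? ∣ D (point u k) ∣
    ... | yes 3≤ = ≤-trans
      (p⊆q⇒∣p∣≤∣q∣ (∪-least (λ i∈ → i∈)
        (⁅x⁆⊆ (degree-3-through-missed (proj₂ missed) (point u k) (incident u k) 3≤))))
      (degree≤3 (point u k))
    ... | no 3≰ = ≤-trans (∣p∪q∣≤∣p∣+∣q∣ (D (point u k)) ⁅ v ⁆)
                          (+-mono-≤ (≤-pred (≰⇒> 3≰)) (≤-reflexive (∣⁅x⁆∣≡1 v)))

    uv : Subset 8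
    uv = ⁅ u ⁆ ∪ ⁅ v ⁆

    uv⊆G : ∀ k → uv ⊆ G k
    uv⊆G k = ∪-monoˡ ⁅ v ⁆ (⁅x⁆⊆ (incident u k))

    2≤∣uv∣ : 2 ≤ ∣ uv ∣
    2≤∣uv∣ = subst (λ c → suc c ≤ ∣ uv ∣) (∣⁅x⁆∣≡1 u) (∣p∣<∣p∪q∣
      -- `u` and `v` differ, since `x` lies on `v` but not on `u`.
      (λ v∈u → proj₂ missed (subst (_∈ _) (x∈⁅y⁆⇒x≡y u v∈u) (p⊆p∪q _ v∈x))) (x∈⁅x⁆ v))

    -- Gluing along `uv` gives 3 + 3 - 2 = 4 for each pair, then 4 + 4 - 2 = 6.
    ∣neighbours∣≤6 : ∣ neighbours u ∣ ≤ 6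
    ∣neighbours∣≤6 = ≤-trans
      (p⊆q⇒∣p∣≤∣q∣ (∪-least
        (p⊆p∪q _ ∘ ∪-least (p⊆p∪q _ ∘ D⊆G (# 0)) (q⊆p∪q (G (# 0)) _ ∘ D⊆G (# 1)))
        (q⊆p∪q (G (# 0) ∪ G (# 1)) _ ∘ ∪-least (p⊆p∪q _ ∘ D⊆G (# 2)) (q⊆p∪q (G (# 2)) _ ∘ D⊆G (# 3)))))
      (∣p∪q∣≤ 6 refl (p⊆p∪q _ ∘ uv⊆G (# 0)) (p⊆p∪q _ ∘ uv⊆G (# 2)) 2≤∣uv∣
        (∣p∪q∣≤ 4 refl (uv⊆G (# 0)) (uv⊆G (# 1)) 2≤∣uv∣ (∣G∣≤3 (# 0)) (∣G∣≤3 (# 1)))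
        (∣p∪q∣≤ 4 refl (uv⊆G (# 2)) (uv⊆G (# 3)) 2≤∣uv∣ (∣G∣≤3 (# 2)) (∣G∣≤3 (# 3))))
      where
      D⊆G : ∀ k → D (point u k) ⊆ G k
      D⊆G k = p⊆p∪q ⁅ v ⁆

  impossible : ⊥
  impossible = <⇒≱ (s≤s (≤-trans (∣neighbours∣≤6 t) (n≤1+n 6))) (8≤∣neighbours∣ (u t))
    where t = triple-through zero

-- Indexing points and blocks.

-- Repetitions are allowed, so that a short list can be indexed by a larger `Fin n`.
record Enumeration {A : Set} (n : ℕ) (P : A → Set) : Set where
  field
    at   : Fin n → A
    at-P : ∀ i → P (at i)
    onto : ∀ {x} → P x → ∃[ i ] at i ≡ x

open Enumeration

enumerate : ∀ {m} (p : Subset m) → Enumeration ∣ p ∣ (_∈ p)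
enumerate [] = record { at = λ () ; at-P = λ () ; onto = λ () }
enumerate (outside ∷ p) = record
  { at   = λ i → suc (at e i)
  ; at-P = λ i → there (at-P e i)
  ; onto = λ { (there x∈p) → let i , eq = onto e x∈p in i , cong suc eq }
  }
  where e = enumerate p
enumerate (inside ∷ p) = record
  { at   = λ { zero → zero ; (suc i) → suc (at e i) }
  ; at-P = λ { zero → here ; (suc i) → there (at-P e i) }
  ; onto = λ { here        → zero , refl
             ; (there x∈p) → let i , eq = onto e x∈p in suc i , cong suc eq }
  }
  where e = enumerate p

pad : ∀ {A : Set} {n} (x : A) xs → length (x ∷ xs) ≤ n → Enumeration n (_∈ₗ x ∷ xs)
pad {n = suc n} x [] _ = record
  -- The last element fills all remaining indices.
  { at   = λ _ → x
  ; at-P = λ _ → here refl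
  ; onto = λ { (here refl) → zero , refl }
  }
pad {n = suc n} x (y ∷ ys) (s≤s len) = record
  { at   = λ { zero → x ; (suc i) → at e i }
  ; at-P = λ { zero → here refl ; (suc i) → there (at-P e i) }
  ; onto = λ { (here refl) → zero , refl
             ; (there z∈)  → let i , eq = onto e z∈ in suc i , eq }
  }
  where e = pad y ys len

-- Passage to the dual and the lower bound.

module _ {m : ℕ} (B : Fin 8 → Subset m) where

  -- The column at `x` of the incidence matrix whose rows are the blocks.
  through : Fin m → Subset 8
  through x = tabulate λ i → lookup (B i) x

  ∈-through⁺ : ∀ {i x} → x ∈ B i → i ∈ through x
  ∈-through⁺ {i} {x} x∈ = lookup⇒[]= i (through x) (trans (lookup∘tabulate (λ i → lookup (B i) x) i) ([]=⇒lookup x∈))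

  ∈-through⁻ : ∀ {i x} → i ∈ through x → x ∈ B i
  ∈-through⁻ {i} {x} i∈ = lookup⇒[]= x (B i) (trans (sym (lookup∘tabulate (λ i → lookup (B i) x) i)) ([]=⇒lookup i∈))

  no-three-cover-impossible :
    (∀ i → ∣ B i ∣ ≡ 4) → (∀ i j → Nonempty (B i ∩ B j)) →
    ¬ (∀ C → (∀ i → Nonempty (C ∩ B i)) → 4 ≤ ∣ C ∣)
  no-three-cover-impossible ∣B∣≡4 intersecting τ≥4 =
    NoThreeCover.impossible through point incident meet noCover
    where
    points : ∀ i → Enumeration 4 (_∈ B i)
    points i = subst (λ k → Enumeration k (_∈ B i)) (∣B∣≡4 i) (enumerate (B i))

    point : Fin 8 → Fin 4 → Fin m
    point i = at (points i)

    incident : ∀ i k → i ∈ through (point i k)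
    incident i k = ∈-through⁺ (at-P (points i) k)

    meet : ∀ i j → ∃[ k ] j ∈ through (point i k)
    meet i j =
      let x , x∈      = intersecting i j
          x∈Bi , x∈Bj = x∈p∩q⁻ (B i) (B j) x∈
          k , eq      = onto (points i) x∈Bi
      in k , ∈-through⁺ (subst (_∈ B j) (sym eq) x∈Bj)

    noCover : ∀ x y z → ∣ (through x ∪ through y) ∪ through z ∣ ≤ 7
    noCover x y z = ≮⇒≥ λ 8≤ → <⇒≱ (s≤s ∣C∣≤3) (τ≥4 C λ i →
      covers i (subst (i ∈_) (sym (∣p∣≡n⇒p≡⊤ (≤-antisym (∣p∣≤n ((through x ∪ through y) ∪ through z)) 8≤))) ∈⊤))
      where
      -- The three points may coincide, hence only an upper bound on the size.
      C = (⁅ x ⁆ ∪ ⁅ y ⁆) ∪ ⁅ z ⁆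

      ∣C∣≤3 : ∣ C ∣ ≤ 3
      ∣C∣≤3 = ≤-trans (∣p∪q∣≤∣p∣+∣q∣ (⁅ x ⁆ ∪ ⁅ y ⁆) ⁅ z ⁆) (+-mono-≤
        (≤-trans (∣p∪q∣≤∣p∣+∣q∣ ⁅ x ⁆ ⁅ y ⁆)
          (+-mono-≤ (≤-reflexive (∣⁅x⁆∣≡1 x)) (≤-reflexive (∣⁅x⁆∣≡1 y))))
        (≤-reflexive (∣⁅x⁆∣≡1 z)))

      covers : ∀ i → i ∈ (through x ∪ through y) ∪ through z → Nonempty (C ∩ B i)
      covers i i∈ with x∈p∪q⁻ (through x ∪ through y) (through z) i∈
      ... | inj₂ i∈z = z , x∈p∩q⁺ (q⊆p∪q (⁅ x ⁆ ∪ ⁅ y ⁆) _ (x∈⁅x⁆ z) , ∈-through⁻ i∈z)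
      ... | inj₁ i∈xy with x∈p∪q⁻ (through x) (through y) i∈xy
      ...   | inj₁ i∈x = x , x∈p∩q⁺ (p⊆p∪q _ (p⊆p∪q _ (x∈⁅x⁆ x)) , ∈-through⁻ i∈x)
      ...   | inj₂ i∈y = y , x∈p∩q⁺ (p⊆p∪q _ (q⊆p∪q ⁅ x ⁆ _ (x∈⁅x⁆ y)) , ∈-through⁻ i∈y)

τ≡4⇒9≤size : ∀ {m} (𝓕 : Family 4 m) → Intersecting 𝓕 → IsTransversalSize 𝓕 4 → 9 ≤ size 𝓕
τ≡4⇒9≤size {m} record { blocks = [] } _ (_ , minimal) =
  -- The empty set covers the empty family.
  contradiction (minimal 0 (Subset.⊥ , (λ ()) , ∣⊥∣≡0 m)) λ ()
τ≡4⇒9≤size 𝓕@record { blocks = F ∷ Fs } intersecting (_ , minimal) = ≰⇒> λ size≤8 →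
  let e = pad F Fs size≤8 in
  no-three-cover-impossible (at e)
    (λ i → uniform 𝓕 (at-P e i))
    (λ i j → intersecting (at-P e i) (at-P e j))
    λ C covers → minimal ∣ C ∣
      (C , (λ G∈ → let i , eq = onto e G∈ in subst (λ G → Nonempty (C ∩ G)) eq (covers i)) , refl)

-- A family of nine blocks attaining the bound.

-- Found by computer search.
example : List (Subset 11)
example = map (⋃ ∘ map ⁅_⁆)
  ( (# 6 ∷ # 8 ∷ # 9 ∷ # 10 ∷ [])
  ∷ (# 0 ∷ # 2 ∷ # 3 ∷ # 6  ∷ [])
  ∷ (# 1 ∷ # 3 ∷ # 4 ∷ # 8  ∷ [])
  ∷ (# 4 ∷ # 5 ∷ # 6 ∷ # 7  ∷ [])
  ∷ (# 2 ∷ # 3 ∷ # 5 ∷ # 10 ∷ [])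
  ∷ (# 0 ∷ # 5 ∷ # 8 ∷ # 9  ∷ [])
  ∷ (# 0 ∷ # 1 ∷ # 5 ∷ # 6  ∷ [])
  ∷ (# 0 ∷ # 4 ∷ # 7 ∷ # 10 ∷ [])
  ∷ (# 1 ∷ # 2 ∷ # 7 ∷ # 9  ∷ [])
  ∷ [])

family : Family 4 11
family = record
  { blocks  = example
  ; unique  = toWitness {a? = unique? (≡-dec Bool._≟_) example} _
  ; uniform = All.lookup (toWitness {a? = All.all? (λ F → ∣ F ∣ ≟ 4) example} _)
  }

family-intersecting : Intersecting family
family-intersecting F∈ G∈ = All.lookup (All.lookup
  (toWitness {a? = All.all? (λ F → All.all? (λ G → nonempty? (F ∩ G)) example) example} _) F∈) G∈

-- Every block of an intersecting family is a covering set; the first one serves as the cover of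
-- size 4.
block-covers : Covers (⋃ (map ⁅_⁆ (# 6 ∷ # 8 ∷ # 9 ∷ # 10 ∷ []))) family
block-covers = family-intersecting (here refl)

-- Decided by exhaustion over the subsets of the 11 points.
no-small-cover : ¬ (∃[ C ] (∣ C ∣ < 4 × All (λ F → Nonempty (C ∩ F)) example))
no-small-cover = toWitnessFalse
  {a? = anySubset? λ C → (∣ C ∣ <? 4) ×-dec All.all? (λ F → nonempty? (C ∩ F)) example} _

family-τ≡4 : IsTransversalSize family 4
family-τ≡4 = (_ , block-covers , refl) , λ where
  _ (C , covers , refl) → ≮⇒≥ λ ∣C∣<4 → no-small-cover (C , ∣C∣<4 , All.tabulate covers)

theorem2p1 : q[ 4 ]≡ 9
theorem2p1 =
    (11 , family , family-intersecting , family-τ≡4 , refl)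
  , λ where _ (_ , 𝓕 , intersecting , τ≡4 , refl) → τ≡4⇒9≤size 𝓕 intersecting τ≡4
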